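{- Let $m\geq 0$ and $r\geq 3$ be integers. For every bad choice $\mathcal{B}$ on $[m]$, $$\operatorname{forb}(m,r,\mathcal{B})-(r-1)^m-m(r-1)^{m-1}\leq H\left(m,\tfrac{r-1}{r-2}\right)\cdot(r-2)^{m-2}.$$
   Context: For a finite set $T$ with $|T|=3$ and $x\in T$, let $e_x\in\{0,1\}^T$ have a 1 in position $x$ and 0 elsewhere, and $\bar e_x=\mathbf 1-e_x$. A choice on $[m]$ is a family $\mathcal{B}=(B_T)_{T\in\binom{[m]}{3}}$ where each $B_T\subseteq\{0,1\}^T$ contains exactly one vector from each of the three pairs $\{e_x,\bar e_x\}$, $x\in T$. $B_T$ is of type $I$ if $B_T=\{e_x:x\in T\}$ and of type $I^c$ if $B_T=\{\bar e_x:x\in T\}$. The choice is bad if some $B_T$ is of type $I$ or $I^c$, and good otherwise. $\operatorname{forb}(m,r,\mathcal{B})$ is the maximum number of columns of a simple (pairwise distinct columns) $m$-rowed matrix with entries in $\{0,\dots,r-1\}$ such that for every column $c$ and every $T\in\binom{[m]}{3}$, $c|_T\notin B_T$. A triangular choice multigraph (TCM) $\mathcal{G}$ on $[m]$ is obtained by choosing, for every 3-element subset $\{u,v,w\}$, exactly one of the pairs $uv,uw,vw$ and adding one copy of it as an edge; $m^{\mathcal{G}}_{xy}$ is the multiplicity of $xy$; $w(\mathcal{G},\alpha)=\sum_{xy\in\binom{[m]}{2}}\alpha^{m^{\mathcal{G}}_{xy}}$ and $H(m,\alpha)$ is the maximum of $w(\mathcal{G},\alpha)$ over all TCMs on $[m]$.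 -}

module Defs where

open import Data.Nat as ℕ using (ℕ; zero; suc; _∸_)
open import Data.Integer using (+_)
open import Data.Fin as Fin using (Fin; toℕ)
open import Data.Fin.Properties using () renaming (_≟_ to _≟ᶠ_)
open import Data.Bool using (Bool; true; false; if_then_else_)
open import Data.Product using (_×_; _,_; Σ; ∃; ∃-syntax)
open import Data.Rational using (ℚ; _/_; 0ℚ; 1ℚ) renaming (_+_ to _+ℚ_; _*_ to _*ℚ_)
open import Relation.Binary.PropositionalEquality using (_≡_)
open import Relation.Nullary using (¬_; yes; no)
open import Relation.Nullary.Decidable using (⌊_⌋)

∑ : (n : ℕ) → (Fin n → ℕ) → ℕ
∑ zero    f = 0
∑ (suc n) f = f Fin.zero ℕ.+ ∑ n (λ i → f (Fin.suc i))

∑ℚ : (n : ℕ) → (Fin n → ℚ) → ℚ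
∑ℚ zero    f = 0ℚ
∑ℚ (suc n) f = f Fin.zero +ℚ ∑ℚ n (λ i → f (Fin.suc i))

_^ℚ_ : ℚ → ℕ → ℚ
q ^ℚ zero  = 1ℚ
q ^ℚ suc n = q *ℚ (q ^ℚ n)

ℕtoℚ : ℕ → ℚ
ℕtoℚ n = + n / 1

-- 3-element subsets of [m] = Fin m are represented as triples a < b < c.
-- Positions inside a triple are indexed by Fin 3 (0 ↦ a, 1 ↦ b, 2 ↦ c).

pick : {m : ℕ} → Fin m → Fin m → Fin m → Fin 3 → Fin m
pick a b c Fin.zero                     = a
pick a b c (Fin.suc Fin.zero)           = b
pick a b c (Fin.suc (Fin.suc Fin.zero)) = c

-- A choice on [m]: for each 3-subset T = {a<b<c} and each position x of T,
-- a boolean: true means e_x ∈ B_T, false means ē_x ∈ B_T.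
-- So B_T = { e_x or ē_x (according to the boolean) : x ∈ T }.
Choice : ℕ → Set
Choice m = (a b c : Fin m) → a Fin.< b → b Fin.< c → Fin 3 → Bool

unitVec : Bool → Fin 3 → Fin 3 → ℕ
unitVec true  x y = if ⌊ x ≟ᶠ y ⌋ then 1 else 0
unitVec false x y = if ⌊ x ≟ᶠ y ⌋ then 0 else 1

TypeI : {m : ℕ} → Choice m → (a b c : Fin m) → a Fin.< b → b Fin.< c → Set
TypeI B a b c p q = (x : Fin 3) → B a b c p q x ≡ true

TypeIᶜ : {m : ℕ} → Choice m → (a b c : Fin m) → a Fin.< b → b Fin.< c → Set
TypeIᶜ B a b c p q = (x : Fin 3) → B a b c p q x ≡ false

Bad : {m : ℕ} → Choice m → Set
Bad {m} B = Σ (Fin m) λ a → Σ (Fin m) λ b → Σ (Fin m) λ c →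
  Σ (a Fin.< b) λ p → Σ (b Fin.< c) λ q → (TypeI B a b c p q) Data.Sum.⊎ (TypeIᶜ B a b c p q)
  where import Data.Sum

Column : ℕ → ℕ → Set
Column m r = Fin m → Fin r

RestrictionIn : {m r : ℕ} → Choice m → Column m r →
                (a b c : Fin m) → a Fin.< b → b Fin.< c → Set
RestrictionIn B col a b c p q =
  ∃[ x ] ((y : Fin 3) → toℕ (col (pick a b c y)) ≡ unitVec (B a b c p q x) x y)

Avoids : {m r : ℕ} → Choice m → Column m r → Set
Avoids B col = ∀ a b c p q → ¬ RestrictionIn B col a b c p q

Matrix : ℕ → ℕ → ℕ → Set
Matrix m r n = Fin n → Column m r

Simple : {m r n : ℕ} → Matrix m r n → Set
Simple {n = n} A = (i j : Fin n) → ((k : _) → A i k ≡ A j k) → i ≡ j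

-- Triangular choice multigraphs: for each triple a<b<c one of the pairs
-- ab (0), ac (1), bc (2).

TCM : ℕ → Set
TCM m = (a b c : Fin m) → a Fin.< b → b Fin.< c → Fin 3

chosenPair : {m : ℕ} → Fin m → Fin m → Fin m → Fin 3 → Fin m × Fin m
chosenPair a b c Fin.zero                     = a , b
chosenPair a b c (Fin.suc Fin.zero)           = a , c
chosenPair a b c (Fin.suc (Fin.suc Fin.zero)) = b , c

indicator : {m : ℕ} → TCM m → Fin m → Fin m → Fin m → Fin m → Fin m → ℕ
indicator G x y a b c with a Fin.<? b | b Fin.<? c
... | yes p | yes q with chosenPair a b c (G a b c p q)
...   | u , v = if ⌊ u ≟ᶠ x ⌋ then (if ⌊ v ≟ᶠ y ⌋ then 1 else 0) else 0
indicator G x y a b c | _ | _ = 0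

mult : {m : ℕ} → TCM m → Fin m → Fin m → ℕ
mult {m} G x y = ∑ m λ a → ∑ m λ b → ∑ m λ c → indicator G x y a b c

weight : {m : ℕ} → TCM m → ℚ → ℚ
weight {m} G α = ∑ℚ m λ x → ∑ℚ m λ y →
  if ⌊ x Fin.<? y ⌋ then α ^ℚ mult G x y else 0ℚ

-- The rational numbers (r-1)/(r-2) and (r-2)^(m-2) (integer exponent),
-- for r ≥ 3 (value for r < 3 is irrelevant: 0).

alpha : ℕ → ℚ
alpha (suc (suc (suc k))) = + (suc (suc k)) / (suc k)
alpha _ = 0ℚ

-- (r-2)^(m-2), exponent possibly negative
scale : ℕ → ℕ → ℚ
scale r (suc (suc j))        = ℕtoℚ ((r ∸ 2) ℕ.^ j)
scale (suc (suc (suc k))) 1  = + 1 / suc k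
scale (suc (suc (suc k))) 0  = + 1 / (suc k ℕ.* suc k)
scale _ _ = 0ℚ

{-# OPTIONS --safe #-}

-- Compress the family F of columns one row at a time: the two families obtained by deleting
-- a 0 and a 1 from that row are replaced by their union (kept under 0) and their intersection
-- (kept under 1).  This preserves the number of columns and commutes with projection to a
-- triple T up to inclusion, so the projection to T of the result D lies in the compression of
-- the complement of B_T.  On {0,1}^T the latter has five elements and is a down-set, hence it
-- contains exactly one vector with two 1s and not 111.  Let G choose that pair for T.  Then a
-- column of D has at most two 1s, and if its 1s are in rows x < y, then its 0s are in rows z
-- with G choosing xy in xyz.  There are (r-1)^m columns without a 1, m (r-1)^(m-1) with one 1,
-- and at most (r-1)^μ (r-2)^(m-2-μ), where μ is the multiplicity of xy, with 1s at x and y.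

module Submission where

open import Defs
open import Data.Nat using (ℕ; zero; suc; _≤_; _∸_; _^_; _*_; _+_; z≤n; s≤s; NonZero)
open import Data.Nat.Properties
open import Data.Integer as ℤ using ()
import Data.Integer.Properties as ℤ
open import Data.Rational as ℚ using (0ℚ; 1ℚ; fromℚᵘ; toℚᵘ)
open import Data.Rational using (ℚ) renaming (_≤_ to _≤ℚ_; _-_ to _-ℚ_; _*_ to _*ℚ_)
import Data.Rational.Properties as ℚ
open import Data.Rational.Unnormalised as ℚᵘ using (mkℚᵘ; *≡*; *≤*)
import Data.Rational.Unnormalised.Properties as ℚᵘ
open import Data.Fin as Fin using (Fin; toℕ)
open import Data.Fin.Properties using (any?; all?)
  renaming (_≟_ to _≟ᶠ_; <-cmp to <ᶠ-cmp; <-irrelevant to <ᶠ-irrelevant; <-irrefl to <ᶠ-irrefl;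
            suc-injective to suc-injectiveᶠ)
open import Data.Bool using (Bool; true; false; _∧_; _∨_; not; if_then_else_)
open import Data.Vec using (Vec; []; _∷_; lookup; tabulate)
open import Data.Vec.Properties using (≡-dec; lookup∘tabulate)
open import Data.Product using (Σ; ∃; _,_; proj₂)
open import Data.Empty using (⊥; ⊥-elim)
open import Function using (_∘_)
open import Algebra.Bundles using (CommutativeMonoid)
open import Algebra.Properties.CommutativeSemigroup +-commutativeSemigroup
  using () renaming (interchange to +-interchange)
open import Algebra.Properties.CommutativeSemigroup *-commutativeSemigroup
  using (x∙yz≈y∙xz) renaming (interchange to *-interchange)
open import Algebra.Properties.CommutativeSemigroup
  (CommutativeMonoid.commutativeSemigroup ℚ.*-1-commutativeMonoid)
  using () renaming (interchange to *ℚ-interchange)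
open import Algebra.Properties.AbelianGroup ℚ.+-0-abelianGroup using (xyx⁻¹≈y)
open import Relation.Nullary using (¬_; Dec; yes; no; contradiction)
open import Relation.Nullary.Decidable using (⌊_⌋; ¬?; _×-dec_; decidable-stable; dec-yes)
open import Relation.Binary using (Tri; tri<; tri≈; tri>)
open import Relation.Binary.PropositionalEquality

private
  variable
    k l m n : ℕ

-- Sums and products

⟦_⟧ : Bool → ℕ
⟦ b ⟧ = if b then 1 else 0

∑-cong : {f g : Fin n → ℕ} → (∀ i → f i ≡ g i) → ∑ n f ≡ ∑ n g
∑-cong {zero}  eq = refl
∑-cong {suc n} eq = cong₂ _+_ (eq Fin.zero) (∑-cong (eq ∘ Fin.suc))

∑-mono-≤ : {f g : Fin n → ℕ} → (∀ i → f i ≤ g i) → ∑ n f ≤ ∑ n g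
∑-mono-≤ {zero}  le = z≤n
∑-mono-≤ {suc n} le = +-mono-≤ (le Fin.zero) (∑-mono-≤ (le ∘ Fin.suc))

∑-distrib-+ : (f g : Fin n → ℕ) → ∑ n (λ i → f i + g i) ≡ ∑ n f + ∑ n g
∑-distrib-+ {zero}  f g = refl
∑-distrib-+ {suc n} f g = trans (cong (f Fin.zero + g Fin.zero +_) (∑-distrib-+ (f ∘ Fin.suc) (g ∘ Fin.suc)))
  (+-interchange (f Fin.zero) (g Fin.zero) _ _)

∑-const : ∀ n c → ∑ n (λ _ → c) ≡ n * c
∑-const zero    c = refl
∑-const (suc n) c = cong (c +_) (∑-const n c)

∑-zero : ∀ n → ∑ n (λ _ → 0) ≡ 0
∑-zero n = trans (∑-const n 0) (*-zeroʳ n)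

∑-*ʳ : (f : Fin n → ℕ) (c : ℕ) → ∑ n (λ i → f i * c) ≡ ∑ n f * c
∑-*ʳ {zero}  f c = refl
∑-*ʳ {suc n} f c = trans (cong (f Fin.zero * c +_) (∑-*ʳ (f ∘ Fin.suc) c))
  (sym (*-distribʳ-+ c (f Fin.zero) _))

term≤∑ : (f : Fin n → ℕ) (i : Fin n) → f i ≤ ∑ n f
term≤∑ f Fin.zero    = m≤m+n _ _
term≤∑ f (Fin.suc i) = ≤-trans (term≤∑ (f ∘ Fin.suc) i) (m≤n+m _ _)

∑-indicator : (x : Fin n) → ∑ n (λ i → ⟦ ⌊ i ≟ᶠ x ⌋ ⟧) ≡ 1
∑-indicator {suc n} Fin.zero = cong suc (∑-zero n)
∑-indicator {suc n} (Fin.suc x) = trans (∑-cong same) (∑-indicator x)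
  where
  same : ∀ i → ⟦ ⌊ Fin.suc i ≟ᶠ Fin.suc x ⌋ ⟧ ≡ ⟦ ⌊ i ≟ᶠ x ⌋ ⟧
  same i with i ≟ᶠ x
  ... | yes _ = refl
  ... | no  _ = refl

-- The summand of `g` at `x` is zero, so `c` may take its place. This separates the parts of an
-- iterated sum in `∑-thirds≤mult`.
∑-replace : (f g : Fin n → ℕ) (x : Fin n) {c : ℕ} →
  (∀ i → g i ≤ f i) → g x ≡ 0 → c ≤ f x → ∑ n g + c ≤ ∑ n f
∑-replace f g Fin.zero {c} le gx≡0 c≤fx rewrite gx≡0 =
  ≤-trans (≤-reflexive (+-comm _ c)) (+-mono-≤ c≤fx (∑-mono-≤ (le ∘ Fin.suc)))
∑-replace f g (Fin.suc x) {c} le gx≡0 c≤fx =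
  ≤-trans (≤-reflexive (+-assoc (g Fin.zero) _ c))
    (+-mono-≤ (le Fin.zero) (∑-replace (f ∘ Fin.suc) (g ∘ Fin.suc) x (le ∘ Fin.suc) gx≡0 c≤fx))

∑-at-most-one : (f : Fin n → ℕ) → (∀ i → f i ≤ 1) →
  (∀ i j → 1 ≤ f i → 1 ≤ f j → i ≡ j) → ∑ n f ≤ 1
∑-at-most-one {zero}  f le un = z≤n
∑-at-most-one {suc n} f le un with f Fin.zero in eq
... | zero = ∑-at-most-one (f ∘ Fin.suc) (le ∘ Fin.suc) λ i j p q → suc-injectiveᶠ (un _ _ p q)
... | suc c = begin
  suc c + ∑ n (f ∘ Fin.suc)  ≡⟨ cong (suc c +_) (trans (∑-cong rest) (∑-zero n)) ⟩
  suc c + 0                  ≡⟨ +-identityʳ _ ⟩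
  suc c                      ≡⟨ eq ⟨
  f Fin.zero                 ≤⟨ le Fin.zero ⟩
  1                          ∎
  where
  open ≤-Reasoning
  rest : ∀ i → f (Fin.suc i) ≡ 0
  rest i with f (Fin.suc i) in eq′
  ... | zero  = refl
  ... | suc _ with () ← un Fin.zero (Fin.suc i) (subst (1 ≤_) (sym eq) (s≤s z≤n))
                                                (subst (1 ≤_) (sym eq′) (s≤s z≤n))

∏ : (n : ℕ) → (Fin n → ℕ) → ℕ
∏ zero    f = 1
∏ (suc n) f = f Fin.zero * ∏ n (f ∘ Fin.suc)

∏-mono-≤ : {f g : Fin n → ℕ} → (∀ i → f i ≤ g i) → ∏ n f ≤ ∏ n g
∏-mono-≤ {zero}  le = ≤-refl
∏-mono-≤ {suc n} le = *-mono-≤ (le Fin.zero) (∏-mono-≤ (le ∘ Fin.suc))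

∏-const : ∀ n c → ∏ n (λ _ → c) ≡ c ^ n
∏-const zero    c = refl
∏-const (suc n) c = cong (c *_) (∏-const n c)

1≤∏ : {f : Fin n → ℕ} → (∀ i → 1 ≤ f i) → 1 ≤ ∏ n f
1≤∏ {n} {f} le = subst (_≤ ∏ n f) (trans (∏-const n 1) (^-zeroˡ n)) (∏-mono-≤ le)

∏-distrib-* : (f g : Fin n → ℕ) → ∏ n (λ i → f i * g i) ≡ ∏ n f * ∏ n g
∏-distrib-* {zero}  f g = refl
∏-distrib-* {suc n} f g = trans (cong (f Fin.zero * g Fin.zero *_) (∏-distrib-* (f ∘ Fin.suc) (g ∘ Fin.suc)))
  (*-interchange (f Fin.zero) (g Fin.zero) _ _)

∏-^ : ∀ c (e : Fin n → ℕ) → ∏ n (λ i → c ^ e i) ≡ c ^ ∑ n e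
∏-^ {zero}  c e = refl
∏-^ {suc n} c e = trans (cong (c ^ e Fin.zero *_) (∏-^ c (e ∘ Fin.suc)))
  (sym (^-distribˡ-+-* c (e Fin.zero) _))

-- Columns are encoded as vectors here: their equality is decidable, and peeling off the first row
-- matches the recursion of `compress`.
∑ᵛ : (m : ℕ) → (Vec (Fin l) m → ℕ) → ℕ
∑ᵛ         zero    f = f []
∑ᵛ {l = l} (suc m) f = ∑ l λ v → ∑ᵛ m λ c → f (v ∷ c)

∑ᵛ-mono-≤ : {f g : Vec (Fin l) m → ℕ} → (∀ c → f c ≤ g c) → ∑ᵛ m f ≤ ∑ᵛ m g
∑ᵛ-mono-≤ {m = zero}  le = le []
∑ᵛ-mono-≤ {m = suc m} le = ∑-mono-≤ λ v → ∑ᵛ-mono-≤ λ c → le (v ∷ c)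

∑ᵛ-distrib-+ : (f g : Vec (Fin l) m → ℕ) → ∑ᵛ m (λ c → f c + g c) ≡ ∑ᵛ m f + ∑ᵛ m g
∑ᵛ-distrib-+ {m = zero}  f g = refl
∑ᵛ-distrib-+ {l = l} {m = suc m} f g =
  trans (∑-cong {l} λ v → ∑ᵛ-distrib-+ {m = m} (f ∘ (v ∷_)) (g ∘ (v ∷_))) (∑-distrib-+ {l} _ _)

∑ᵛ-zero : ∀ m → ∑ᵛ {l} m (λ _ → 0) ≡ 0
∑ᵛ-zero         zero    = refl
∑ᵛ-zero {l = l} (suc m) = trans (∑-cong {l} λ _ → ∑ᵛ-zero m) (∑-zero l)

∑ᵛ-∑-comm : (f : Vec (Fin l) m → Fin n → ℕ) → ∑ᵛ m (λ c → ∑ n (f c)) ≡ ∑ n (λ i → ∑ᵛ m (λ c → f c i))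
∑ᵛ-∑-comm {m = m} {n = zero}  f = ∑ᵛ-zero m
∑ᵛ-∑-comm {m = m} {n = suc n} f = trans (∑ᵛ-distrib-+ {m = m} _ _)
  (cong (∑ᵛ m (λ c → f c Fin.zero) +_) (∑ᵛ-∑-comm {m = m} λ c → f c ∘ Fin.suc))

-- Expanding the product chooses one entry in each row. Indicators that factor over the rows are
-- counted in this way.
∑ᵛ-∏ : (φ : Fin m → Fin l → ℕ) → ∑ᵛ m (λ c → ∏ m λ i → φ i (lookup c i)) ≡ ∏ m λ i → ∑ l (φ i)
∑ᵛ-∏ {m = zero}      φ = refl
∑ᵛ-∏ {m = suc m} {l} φ = begin
  ∑ l (λ v → ∑ᵛ m λ c → φ Fin.zero v * R c)        ≡⟨ (∑-cong λ v → ∑ᵛ-*ˡ (φ Fin.zero v) R) ⟩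
  ∑ l (λ v → φ Fin.zero v * ∑ᵛ m R)                ≡⟨ ∑-*ʳ (φ Fin.zero) (∑ᵛ m R) ⟩
  ∑ l (φ Fin.zero) * ∑ᵛ m R                        ≡⟨ cong (∑ l (φ Fin.zero) *_) (∑ᵛ-∏ (φ ∘ Fin.suc)) ⟩
  ∑ l (φ Fin.zero) * ∏ m (λ i → ∑ l (φ (Fin.suc i))) ∎
  where
  open ≡-Reasoning
  R : Vec (Fin l) m → ℕ
  R c = ∏ m λ i → φ (Fin.suc i) (lookup c i)
  ∑ᵛ-*ˡ : ∀ {m} a (g : Vec (Fin l) m → ℕ) → ∑ᵛ m (λ c → a * g c) ≡ a * ∑ᵛ m g
  ∑ᵛ-*ˡ {zero}  a g = refl
  ∑ᵛ-*ˡ {suc m} a g = trans (∑-cong {l} λ v → trans (∑ᵛ-*ˡ {m} a (g ∘ (v ∷_))) (*-comm a _))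
    (trans (∑-*ʳ {l} _ a) (*-comm _ a))

∑ᵛ-indicator : (d : Vec (Fin l) m) → 1 ≤ ∑ᵛ m (λ c → ⟦ ⌊ ≡-dec _≟ᶠ_ d c ⌋ ⟧)
∑ᵛ-indicator d = ≤-trans (≤-reflexive (sym at-d)) (term≤∑ᵛ (λ c → ⟦ ⌊ ≡-dec _≟ᶠ_ d c ⌋ ⟧) d)
  where
  at-d : ⟦ ⌊ ≡-dec _≟ᶠ_ d d ⌋ ⟧ ≡ 1
  at-d with ≡-dec _≟ᶠ_ d d
  ... | yes _  = refl
  ... | no d≢d = contradiction refl d≢d
  term≤∑ᵛ : ∀ {m} (f : Vec (Fin l) m → ℕ) d → f d ≤ ∑ᵛ m f
  term≤∑ᵛ f []      = ≤-refl
  term≤∑ᵛ f (v ∷ d) = ≤-trans (term≤∑ᵛ (f ∘ (v ∷_)) d) (term≤∑ _ v)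

-- Compression

-- `k` stands for r - 2, the number of symbols other than 0 and 1.
Family : ℕ → ℕ → Set
Family k m = Vec (Fin (2 + k)) m → Bool

pattern 𝟘 = Fin.zero
pattern 𝟙 = Fin.suc Fin.zero
pattern 𝟚+ v = Fin.suc (Fin.suc v)

-- The sections, by first entry, of the family after compression of its first row alone; `compress`
-- continues inside each section.
link : Fin (2 + k) → Family k (suc m) → Family k m
link 𝟘      P c = P (𝟘 ∷ c) ∨ P (𝟙 ∷ c)
link 𝟙      P c = P (𝟘 ∷ c) ∧ P (𝟙 ∷ c)
link (𝟚+ v) P c = P (𝟚+ v ∷ c)

compress : Family k m → Family k m
compress P []      = P []
compress P (v ∷ c) = compress (link v P) c

size : Family k m → ℕ
size {m = m} P = ∑ᵛ m λ c → ⟦ P c ⟧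

-- Two sections are traded for their union and their intersection, which have the same total size;
-- induction handles the remaining rows.
size≤compress : (P : Family k m) → size P ≤ size (compress P)
size≤compress {m = zero}          P = ≤-refl
size≤compress {k = k} {m = suc m} P = begin
  s₀ + (s₁ + ∑ k s₂)                  ≡⟨ +-assoc s₀ s₁ _ ⟨
  s₀ + s₁ + ∑ k s₂                    ≡⟨ cong (_+ ∑ k s₂) (∑ᵛ-distrib-+ {m = m} _ _) ⟨
  ∑ᵛ m (λ c → ⟦ P (𝟘 ∷ c) ⟧ + ⟦ P (𝟙 ∷ c) ⟧) + ∑ k s₂
    ≤⟨ +-monoˡ-≤ _ (∑ᵛ-mono-≤ {m = m} λ c → ∨-∧-+ (P (𝟘 ∷ c)) (P (𝟙 ∷ c))) ⟩
  ∑ᵛ m (λ c → ⟦ link 𝟘 P c ⟧ + ⟦ link 𝟙 P c ⟧) + ∑ k s₂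
    ≡⟨ cong (_+ ∑ k s₂) (∑ᵛ-distrib-+ {m = m} _ _) ⟩
  size (link 𝟘 P) + size (link 𝟙 P) + ∑ k s₂
    ≤⟨ +-mono-≤ (+-mono-≤ (size≤compress (link 𝟘 P)) (size≤compress (link 𝟙 P)))
                (∑-mono-≤ λ v → size≤compress (link (𝟚+ v) P)) ⟩
  size (compress (link 𝟘 P)) + size (compress (link 𝟙 P)) + ∑ k (λ v → size (compress (link (𝟚+ v) P)))
    ≡⟨ +-assoc (size (compress (link 𝟘 P))) _ _ ⟩
  size (compress P) ∎
  where
  open ≤-Reasoning
  s₀ = size (λ c → P (𝟘 ∷ c))
  s₁ = size (λ c → P (𝟙 ∷ c))
  s₂ = λ v → size (λ c → P (𝟚+ v ∷ c))
  ∨-∧-+ : ∀ a b → ⟦ a ⟧ + ⟦ b ⟧ ≤ ⟦ a ∨ b ⟧ + ⟦ a ∧ b ⟧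
  ∨-∧-+ false false = ≤-refl
  ∨-∧-+ false true  = ≤-refl
  ∨-∧-+ true  false = ≤-refl
  ∨-∧-+ true  true  = ≤-refl

-- A choice of `n` rows out of `m`, built row by row in step with `compress`.
data _⊑_ : ℕ → ℕ → Set where
  done : 0 ⊑ 0
  skip : n ⊑ m → n ⊑ suc m
  keep : n ⊑ m → suc n ⊑ suc m

project : {A : Set} → n ⊑ m → Vec A m → Vec A n
project done     []      = []
project (skip θ) (x ∷ v) = project θ v
project (keep θ) (x ∷ v) = x ∷ project θ v

-- The inclusion of the projection of `P` in `K` passes to the sections at every row. It reduces
-- questions about three rows of the compressed family to a compression on three rows.
compress-project : (θ : n ⊑ m) (P : Family k m) (K : Family k n) →
  (∀ c → P c ≡ true → K (project θ c) ≡ true) →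
  ∀ c → compress P c ≡ true → compress K (project θ c) ≡ true
compress-project done     P K sub []      = sub []
-- A row outside the projection: the union and the intersection of two sections still project into
-- `K`.
compress-project (skip θ) P K sub (v ∷ c) = compress-project θ (link v P) K (sub′ v) c
  where
  sub′ : ∀ v c → link v P c ≡ true → K (project θ c) ≡ true
  sub′ 𝟘 c eq with P (𝟘 ∷ c) in eq₀
  ... | true  = sub (𝟘 ∷ c) eq₀
  ... | false = sub (𝟙 ∷ c) eq
  sub′ 𝟙 c eq with P (𝟘 ∷ c) in eq₀
  ... | true  = sub (𝟘 ∷ c) eq₀
  sub′ 𝟙 c () | false
  sub′ (𝟚+ v) c eq = sub (𝟚+ v ∷ c) eq
-- A projected row is compressed in `P` and `K` alike, and union and intersection are monotone.
compress-project (keep θ) P K sub (v ∷ c) = compress-project θ (link v P) (link v K) (sub′ v) c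
  where
  ∨-true : ∀ {a} b → a ≡ true → b ∨ a ≡ true
  ∨-true false eq = eq
  ∨-true true  eq = refl
  sub′ : ∀ v c → link v P c ≡ true → link v K (project θ c) ≡ true
  sub′ 𝟘 c eq with P (𝟘 ∷ c) in eq₀
  ... | true  rewrite sub (𝟘 ∷ c) eq₀ = refl
  ... | false = ∨-true (K (𝟘 ∷ project θ c)) (sub (𝟙 ∷ c) eq)
  sub′ 𝟙 c eq with P (𝟘 ∷ c) in eq₀
  ... | true  rewrite sub (𝟘 ∷ c) eq₀ = sub (𝟙 ∷ c) eq
  sub′ 𝟙 c () | false
  sub′ (𝟚+ v) c eq = sub (𝟚+ v ∷ c) eq

thin₁ : (c : Fin m) → Σ (1 ⊑ m) λ θ → ∀ {l} (v : Vec (Fin l) m) → project θ v ≡ lookup v c ∷ []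
thin₁ 𝟘 = keep none , λ { (x ∷ v) → cong (x ∷_) (project-none v) }
  where
  none : ∀ {m} → 0 ⊑ m
  none {zero}  = done
  none {suc m} = skip none
  project-none : ∀ {l m} (v : Vec (Fin l) m) → project none v ≡ []
  project-none []      = refl
  project-none (x ∷ v) = project-none v
thin₁ (Fin.suc c) with θ , eq ← thin₁ c = skip θ , λ { (x ∷ v) → eq v }

thin₂ : {b c : Fin m} → b Fin.< c →
  Σ (2 ⊑ m) λ θ → ∀ {l} (v : Vec (Fin l) m) → project θ v ≡ lookup v b ∷ lookup v c ∷ []
thin₂ {b = 𝟘}         {Fin.suc c} q       with θ , eq ← thin₁ c = keep θ , λ { (x ∷ v) → cong (x ∷_) (eq v) }
thin₂ {b = Fin.suc b} {Fin.suc c} (s≤s q) with θ , eq ← thin₂ q = skip θ , λ { (x ∷ v) → eq v }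

-- One thinning serves all vectors, since `restrict` applies the equation both to members of `P` and
-- to the compressed column.
thin₃ : {a b c : Fin m} → a Fin.< b → b Fin.< c →
  Σ (3 ⊑ m) λ θ → ∀ {l} (v : Vec (Fin l) m) → project θ v ≡ lookup v a ∷ lookup v b ∷ lookup v c ∷ []
thin₃ {a = 𝟘}         {Fin.suc b} {Fin.suc c} p       (s≤s q) with θ , eq ← thin₂ q   = keep θ , λ { (x ∷ v) → cong (x ∷_) (eq v) }
thin₃ {a = Fin.suc a} {Fin.suc b} {Fin.suc c} (s≤s p) (s≤s q) with θ , eq ← thin₃ p q = skip θ , λ { (x ∷ v) → eq v }

-- The compressed complement of B_T

-- `s` lists the three booleans of the choice at T as a vector, so that its eight cases can be split
-- and decided by computation.
forbidden? : (s : Vec Bool 3) (v : Vec (Fin l) 3) →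
  Dec (∃ λ x → (y : Fin 3) → toℕ (lookup v y) ≡ unitVec (lookup s x) x y)
forbidden? s v = any? λ x → all? λ y → toℕ (lookup v y) ≟ unitVec (lookup s x) x y

allowed : Vec Bool 3 → Family k 3
allowed s v = not ⌊ forbidden? s v ⌋

-- The compression contains 111 only if the original set contains all eight vectors of {0,1}^T, and
-- those of B_T are missing.
compress-allowed-𝟙𝟙𝟙 : ∀ s → compress (allowed {k} s) (𝟙 ∷ 𝟙 ∷ 𝟙 ∷ []) ≡ false
compress-allowed-𝟙𝟙𝟙 (false ∷ false ∷ false ∷ []) = refl
compress-allowed-𝟙𝟙𝟙 (false ∷ false ∷ true  ∷ []) = refl
compress-allowed-𝟙𝟙𝟙 (false ∷ true  ∷ false ∷ []) = refl
compress-allowed-𝟙𝟙𝟙 (false ∷ true  ∷ true  ∷ []) = refl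
compress-allowed-𝟙𝟙𝟙 (true  ∷ false ∷ false ∷ []) = refl
compress-allowed-𝟙𝟙𝟙 (true  ∷ false ∷ true  ∷ []) = refl
compress-allowed-𝟙𝟙𝟙 (true  ∷ true  ∷ false ∷ []) = refl
compress-allowed-𝟙𝟙𝟙 (true  ∷ true  ∷ true  ∷ []) = refl

-- The index is the position of the pair carrying the 1s, numbered as in `chosenPair`.
doubleOnes : Fin 3 → Vec (Fin (2 + k)) 3
doubleOnes 𝟘      = 𝟙 ∷ 𝟙 ∷ 𝟘 ∷ []
doubleOnes 𝟙      = 𝟙 ∷ 𝟘 ∷ 𝟙 ∷ []
doubleOnes (𝟚+ _) = 𝟘 ∷ 𝟙 ∷ 𝟙 ∷ []

-- The last alternative is forced: 000 and the vectors with a single 1 are only four of the five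
-- elements, and 111 is excluded.
survivor : Vec Bool 3 → Fin 3
survivor s = if compress (allowed {0} s) (doubleOnes 𝟘) then 𝟘 else
             if compress (allowed {0} s) (doubleOnes 𝟙) then 𝟙 else 𝟚+ 𝟘

-- Two vectors with two 1s would bring 000 and all three vectors with one 1 into the down-set, which
-- makes six elements instead of five.
survivor-unique : ∀ s i → compress (allowed {k} s) (doubleOnes i) ≡ true → survivor s ≡ i
survivor-unique {k} s i eq = trans (sym (helper s i)) (cong (if_then i else survivor s) eq)
  where
  -- Quantified over all s and i without a hypothesis, each instance holds by computation.
  helper : ∀ s i → (if compress (allowed {k} s) (doubleOnes i) then i else survivor s) ≡ survivor s
  helper (false ∷ false ∷ false ∷ []) = λ { 𝟘 → refl ; 𝟙 → refl ; (𝟚+ 𝟘) → refl }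
  helper (false ∷ false ∷ true  ∷ []) = λ { 𝟘 → refl ; 𝟙 → refl ; (𝟚+ 𝟘) → refl }
  helper (false ∷ true  ∷ false ∷ []) = λ { 𝟘 → refl ; 𝟙 → refl ; (𝟚+ 𝟘) → refl }
  helper (false ∷ true  ∷ true  ∷ []) = λ { 𝟘 → refl ; 𝟙 → refl ; (𝟚+ 𝟘) → refl }
  helper (true  ∷ false ∷ false ∷ []) = λ { 𝟘 → refl ; 𝟙 → refl ; (𝟚+ 𝟘) → refl }
  helper (true  ∷ false ∷ true  ∷ []) = λ { 𝟘 → refl ; 𝟙 → refl ; (𝟚+ 𝟘) → refl }
  helper (true  ∷ true  ∷ false ∷ []) = λ { 𝟘 → refl ; 𝟙 → refl ; (𝟚+ 𝟘) → refl }
  helper (true  ∷ true  ∷ true  ∷ []) = λ { 𝟘 → refl ; 𝟙 → refl ; (𝟚+ 𝟘) → refl }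

survivorTCM : Choice m → TCM m
survivorTCM B a b c p q = survivor (tabulate (B a b c p q))

module _ (B : Choice m) (P : Family k m) (avoids : ∀ c → P c ≡ true → Avoids B (lookup c))
         (d : Vec (Fin (2 + k)) m) (d∈ : compress P d ≡ true) where

  -- Members of `P` avoid B_T, hence project into `allowed`; `compress-project` transfers this to
  -- `d`.
  restrict : ∀ {a b c} (p : a Fin.< b) (q : b Fin.< c) →
    compress (allowed (tabulate (B a b c p q))) (lookup d a ∷ lookup d b ∷ lookup d c ∷ []) ≡ true
  restrict {a} {b} {c} p q with θ , eq ← thin₃ p q =
    subst (λ v → compress (allowed s) v ≡ true) (eq d) (compress-project θ P (allowed s) sub d d∈)
    where
    s = tabulate (B a b c p q)
    sub : ∀ c′ → P c′ ≡ true → allowed s (project θ c′) ≡ true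
    sub c′ c′∈ with forbidden? s (project θ c′)
    ... | no  _       = refl
    ... | yes (x , h) = ⊥-elim (avoids c′ c′∈ a b c p q (x , λ y → begin
      toℕ (lookup c′ (pick a b c y))             ≡⟨ cong toℕ (at y) ⟩
      toℕ (lookup (project θ c′) y)              ≡⟨ h y ⟩
      unitVec (lookup s x) x y                   ≡⟨ cong (λ β → unitVec β x y) (lookup∘tabulate (B a b c p q) x) ⟩
      unitVec (B a b c p q x) x y                ∎))
      where
      open ≡-Reasoning
      at : ∀ y → lookup c′ (pick a b c y) ≡ lookup (project θ c′) y
      at y rewrite eq c′ with y
      ... | 𝟘    = refl
      ... | 𝟙    = refl
      ... | 𝟚+ 𝟘 = refl

  no-three-𝟙s : ∀ {a b c} → a Fin.< b → b Fin.< c →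
    lookup d a ≡ 𝟙 → lookup d b ≡ 𝟙 → lookup d c ≡ 𝟙 → ⊥
  no-three-𝟙s {a} {b} {c} p q da db dc with h ← restrict p q
    rewrite da | db | dc | compress-allowed-𝟙𝟙𝟙 {k} (tabulate (B a b c p q)) with () ← h

  two-𝟙s : ∀ {a b c} (p : a Fin.< b) (q : b Fin.< c) i →
    lookup d a ∷ lookup d b ∷ lookup d c ∷ [] ≡ doubleOnes i → survivorTCM B a b c p q ≡ i
  two-𝟙s {a} {b} {c} p q i eq = survivor-unique {k} (tabulate (B a b c p q)) i
    (subst (λ v → compress (allowed (tabulate (B a b c p q))) v ≡ true) eq (restrict p q))

-- Multiplicities

indicator-chosen : ∀ (G : TCM m) {x y a b c} (p : a Fin.< b) (q : b Fin.< c) →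
  chosenPair a b c (G a b c p q) ≡ (x , y) → 1 ≤ indicator G x y a b c
indicator-chosen G {x} {y} {a} {b} {c} p q eq with a Fin.<? b | b Fin.<? c
... | no ¬p | _     = contradiction p ¬p
... | yes _ | no ¬q = contradiction q ¬q
-- `indicator` decides the order by itself; its order proofs are identified with `p` and `q`.
... | yes p′ | yes q′ rewrite <ᶠ-irrelevant p′ p | <ᶠ-irrelevant q′ q | eq
  with x ≟ᶠ x | y ≟ᶠ y
...   | yes _  | yes _  = ≤-refl
...   | no x≢x | _      = contradiction refl x≢x
...   | yes _  | no y≢y = contradiction refl y≢y

indicator-≮ˡ : ∀ (G : TCM m) x y {a b} c → ¬ a Fin.< b → indicator G x y a b c ≡ 0
indicator-≮ˡ G x y {a} {b} c ¬p with a Fin.<? b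
... | yes p = contradiction p ¬p
... | no _  = refl

indicator-≮ʳ : ∀ (G : TCM m) x y a {b c} → ¬ b Fin.< c → indicator G x y a b c ≡ 0
indicator-≮ʳ G x y a {b} {c} ¬q with a Fin.<? b | b Fin.<? c
... | _     | yes q = contradiction q ¬q
... | yes _ | no _  = refl
... | no _  | no _  = refl

-- For x < y this is 1 if G chooses xy in the triple xyz and 0 otherwise: at most one summand is
-- nonzero, as the indicator vanishes on triples that are not increasing.
thirds : TCM m → Fin m → Fin m → Fin m → ℕ
thirds G x y z = indicator G x y z x y + indicator G x y x z y + indicator G x y x y z

-- The three sums over z run along lines of the triple sum. The line (z, x, y) vanishes at z = x,
-- which leaves the slice with first index x to the other two; in that slice the line (x, z, y)
-- vanishes at z = y, which leaves room for the line (x, y, z).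
∑-thirds≤mult : (G : TCM m) (x y : Fin m) → ∑ m (thirds G x y) ≤ mult G x y
∑-thirds≤mult {m} G x y = begin
  ∑ m (thirds G x y)                                       ≡⟨ ∑-distrib-+ {m} _ _ ⟩
  ∑ m (λ z → g z x y + g x z y) + ∑ m (λ z → g x y z)      ≡⟨ cong (_+ ∑ m (λ z → g x y z)) (∑-distrib-+ {m} _ _) ⟩
  ∑ m (λ z → g z x y) + ∑ m (λ z → g x z y) + ∑ m (g x y)  ≡⟨ +-assoc (∑ m (λ z → g z x y)) _ _ ⟩
  ∑ m (λ z → g z x y) + (∑ m (λ z → g x z y) + ∑ m (g x y))
    ≤⟨ ∑-replace _ (λ a → g a x y) x
         (λ a → ≤-trans (term≤∑ (g a x) y) (term≤∑ (λ b → ∑ m (g a b)) x))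
         (indicator-≮ˡ G x y y (<ᶠ-irrefl {x = x} refl))
         (∑-replace _ (λ b → g x b y) y (λ b → term≤∑ (g x b) y)
           (indicator-≮ʳ G x y x (<ᶠ-irrefl {x = y} refl)) ≤-refl) ⟩
  mult G x y ∎
  where
  open ≤-Reasoning
  g = indicator G x y

thirds-endpointˡ : ∀ (G : TCM m) {x y} → x Fin.< y → thirds G x y x ≡ 0
thirds-endpointˡ G {x} {y} x<y = cong₂ _+_
  (cong₂ _+_ (indicator-≮ˡ G x y y x≮x) (indicator-≮ˡ G x y y x≮x)) (indicator-≮ʳ G x y x (<-asym x<y))
  where x≮x = <ᶠ-irrefl {x = x} refl

thirds-endpointʳ : ∀ (G : TCM m) {x y} → x Fin.< y → thirds G x y y ≡ 0
thirds-endpointʳ G {x} {y} x<y = cong₂ _+_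
  (cong₂ _+_ (indicator-≮ˡ G x y y (<-asym x<y)) (indicator-≮ʳ G x y x y≮y)) (indicator-≮ʳ G x y x y≮y)
  where y≮y = <ᶠ-irrefl {x = y} refl

-- In the sorted triple the pair xy has index 2, 1 or 0 according as z lies before, between or after
-- x and y. Quantifying over order proofs lets a caller supply all three hypotheses without knowing
-- where z lies.
1≤thirds : ∀ (G : TCM m) {x y z} → x Fin.< y → z ≢ x → z ≢ y →
  (∀ p q → G z x y p q ≡ 𝟚+ 𝟘) → (∀ p q → G x z y p q ≡ 𝟙) → (∀ p q → G x y z p q ≡ 𝟘) →
  1 ≤ thirds G x y z
1≤thirds G {x} {y} {z} x<y z≢x z≢y zxy xzy xyz = by-order (<ᶠ-cmp z x) (<ᶠ-cmp z y)
  where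
  i₁ = indicator G x y z x y
  i₂ = indicator G x y x z y
  i₃ = indicator G x y x y z
  by-order : Tri (z Fin.< x) (z ≡ x) (x Fin.< z) → Tri (z Fin.< y) (z ≡ y) (y Fin.< z) → 1 ≤ i₁ + i₂ + i₃
  by-order (tri≈ _ z≡x _) _              = contradiction z≡x z≢x
  by-order _              (tri≈ _ z≡y _) = contradiction z≡y z≢y
  by-order (tri< z<x _ _) _              =
    ≤-trans (indicator-chosen G z<x x<y (cong (chosenPair z x y) (zxy z<x x<y)))
      (≤-trans (m≤m+n i₁ i₂) (m≤m+n (i₁ + i₂) i₃))
  by-order (tri> _ _ x<z) (tri< z<y _ _) =
    ≤-trans (indicator-chosen G x<z z<y (cong (chosenPair x z y) (xzy x<z z<y)))
      (≤-trans (m≤n+m i₂ i₁) (m≤m+n (i₁ + i₂) i₃))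
  by-order (tri> _ _ x<z) (tri> _ _ y<z) =
    ≤-trans (indicator-chosen G x<y y<z (cong (chosenPair x y z) (xyz x<y y<z)))
      (m≤n+m i₃ (i₁ + i₂))

-- Counting columns by their 1s

cell : ℕ → ℕ → ℕ → Fin (2 + k) → ℕ
cell a b c 𝟘      = a
cell a b c 𝟙      = b
cell a b c (𝟚+ _) = c

∑-cell : ∀ k a b c → ∑ (2 + k) (cell a b c) ≡ a + (b + k * c)
∑-cell k a b c = cong (λ t → a + (b + t)) (∑-const k c)

-- The factor of one row in the indicator of a set of columns with prescribed 1s; β marks the
-- rows prescribed to contain a 1, and t says whether a 0 is permitted in another row.
slot : Bool → ℕ → Fin (2 + k) → ℕ
slot β t = if β then cell 0 1 0 else cell t 0 1

∑-slot : ∀ k β t → ∑ (2 + k) (slot β t) ≡ (if β then 1 else t + k)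
∑-slot k true  t = trans (∑-cell k 0 1 0) (cong suc (*-zeroʳ k))
∑-slot k false t = trans (∑-cell k t 0 1) (cong (t +_) (*-identityʳ k))

-- Bernoulli's inequality 1 + t/k ≤ (1 + 1/k)^t with denominators cleared. It compares the t + k
-- options of a row other than x and y with k α^t.
bernoulli : ∀ k t → (t + k) * k ^ t ≤ k * suc k ^ t
bernoulli k zero    = ≤-refl
bernoulli k (suc t) = begin
  suc (t + k) * (k * k ^ t)    ≡⟨ *-assoc (suc (t + k)) k _ ⟨
  suc (t + k) * k * k ^ t      ≤⟨ *-monoˡ-≤ (k ^ t) step ⟩
  suc k * (t + k) * k ^ t      ≡⟨ *-assoc (suc k) (t + k) _ ⟩
  suc k * ((t + k) * k ^ t)    ≤⟨ *-monoʳ-≤ (suc k) (bernoulli k t) ⟩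
  suc k * (k * suc k ^ t)      ≡⟨ x∙yz≈y∙xz (suc k) k _ ⟩
  k * (suc k * suc k ^ t)      ∎
  where
  open ≤-Reasoning
  step : suc (t + k) * k ≤ suc k * (t + k)
  step = +-mono-≤ (m≤n+m k t) (≤-reflexive (*-comm (t + k) k))

-- The product of the row estimates f i ≤ b d^(e′ i) / c^(e i), with denominators cleared.
∏-bound : ∀ (f e e′ : Fin n → ℕ) {b c d} →
  (∀ i → f i * c ^ e i ≤ b * d ^ e′ i) → ∏ n f * c ^ ∑ n e ≤ b ^ n * d ^ ∑ n e′
∏-bound {n} f e e′ {b} {c} {d} le = begin
  ∏ n f * c ^ ∑ n e                      ≡⟨ cong (∏ n f *_) (∏-^ c e) ⟨
  ∏ n f * ∏ n (λ i → c ^ e i)            ≡⟨ ∏-distrib-* f _ ⟨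
  ∏ n (λ i → f i * c ^ e i)              ≤⟨ ∏-mono-≤ le ⟩
  ∏ n (λ i → b * d ^ e′ i)               ≡⟨ ∏-distrib-* {n} _ _ ⟩
  ∏ n (λ _ → b) * ∏ n (λ i → d ^ e′ i)   ≡⟨ cong₂ _*_ (∏-const n b) (∏-^ d e′) ⟩
  b ^ n * d ^ ∑ n e′                     ∎
  where open ≤-Reasoning

noOnes : Vec (Fin (2 + k)) m → ℕ
noOnes {m = m} c = ∏ m λ i → slot false 1 (lookup c i)

oneOne : Fin m → Vec (Fin (2 + k)) m → ℕ
oneOne {m} x c = ∏ m λ i → slot ⌊ i ≟ᶠ x ⌋ 1 (lookup c i)

isEnd : Fin m → Fin m → Fin m → Bool
isEnd x y i = ⌊ i ≟ᶠ x ⌋ ∨ ⌊ i ≟ᶠ y ⌋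

twoOnes : TCM m → Fin m → Fin m → Vec (Fin (2 + k)) m → ℕ
twoOnes {m} G x y c = ∏ m λ i → slot (isEnd x y i) (thirds G x y i) (lookup c i)

∑<∑ : (Fin m → Fin m → ℕ) → ℕ
∑<∑ {m} e = ∑ m λ x → ∑ m λ y → if ⌊ x Fin.<? y ⌋ then e x y else 0

term≤∑<∑ : ∀ (e : Fin m → Fin m → ℕ) {x y} → x Fin.< y → e x y ≤ ∑<∑ e
term≤∑<∑ {m} e {x} {y} x<y =
  ≤-trans e≤f (≤-trans (term≤∑ (f x) y) (term≤∑ (λ x → ∑ m (f x)) x))
  where
  f : Fin m → Fin m → ℕ
  f x y = if ⌊ x Fin.<? y ⌋ then e x y else 0
  e≤f : e x y ≤ f x y
  e≤f = ≤-reflexive (cong (if_then e x y else 0) (sym (cong ⌊_⌋ (dec-yes (x Fin.<? y) x<y .proj₂))))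

-- A majorant of the indicator of the compressed family, split by the number of 1s into terms that
-- factor over the rows.
cover : TCM m → Vec (Fin (2 + k)) m → ℕ
cover {m} G d = noOnes d + (∑ m (λ x → oneOne x d) + ∑<∑ λ x y → twoOnes G x y d)

1≤twoOnes : ∀ (G : TCM m) {x y} {d : Vec (Fin (2 + k)) m} → lookup d x ≡ 𝟙 → lookup d y ≡ 𝟙 →
  (∀ {z} → z ≢ x → z ≢ y → lookup d z ≡ 𝟘 → 1 ≤ thirds G x y z) →
  (∀ {z} → z ≢ x → z ≢ y → lookup d z ≢ 𝟙) → 1 ≤ twoOnes G x y d
1≤twoOnes G {x} {y} {d} dx dy third≥1 no-third = 1≤∏ λ i → 1≤slot i (thirds G x y i) third≥1
  where
  1≤slot : ∀ i t → (i ≢ x → i ≢ y → lookup d i ≡ 𝟘 → 1 ≤ t) → 1 ≤ slot (isEnd x y i) t (lookup d i)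
  1≤slot i t 1≤t with i ≟ᶠ x | i ≟ᶠ y
  ... | yes refl | _        rewrite dx = ≤-refl
  ... | no _     | yes refl rewrite dy = ≤-refl
  ... | no i≢x   | no i≢y with lookup d i in di
  ...   | 𝟘    = 1≤t i≢x i≢y refl
  ...   | 𝟙    = contradiction di (no-third i≢x i≢y)
  ...   | 𝟚+ _ = ≤-refl

∑ᵛ-noOnes : ∀ m → ∑ᵛ m (noOnes {k}) ≡ suc k ^ m
∑ᵛ-noOnes {k} m = begin
  ∑ᵛ m (noOnes {k})                           ≡⟨ ∑ᵛ-∏ {m} (λ _ → slot false 1) ⟩
  ∏ m (λ _ → ∑ (2 + k) (slot false 1))        ≡⟨ ∏-const m _ ⟩
  ∑ (2 + k) (slot false 1) ^ m                ≡⟨ cong (_^ m) (∑-slot k false 1) ⟩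
  suc k ^ m                                   ∎
  where open ≡-Reasoning

-- Row `x` has one option and every other row k + 1. An extra factor k + 1 makes all rows alike and
-- is cancelled from (k + 1)^(m + 1).
∑ᵛ-oneOne : (x : Fin (suc m)) → ∑ᵛ (suc m) (oneOne {k = k} x) ≤ suc k ^ m
∑ᵛ-oneOne {m} {k} x = *-cancelˡ-≤ (suc k) (begin
  suc k * ∑ᵛ (suc m) (oneOne x)      ≡⟨ cong (suc k *_) (∑ᵛ-∏ λ i → slot {k} ⌊ i ≟ᶠ x ⌋ 1) ⟩
  suc k * ∏ (suc m) W                ≡⟨ *-comm (suc k) _ ⟩
  ∏ (suc m) W * suc k                ≡⟨ cong (∏ (suc m) W *_) (*-identityʳ (suc k)) ⟨
  ∏ (suc m) W * suc k ^ 1            ≡⟨ cong (λ e → ∏ (suc m) W * suc k ^ e) (∑-indicator x) ⟨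
  ∏ (suc m) W * suc k ^ ∑ (suc m) δ  ≤⟨ ∏-bound W δ δ bound ⟩
  suc k ^ suc m * 1 ^ ∑ (suc m) δ    ≡⟨ cong (suc k ^ suc m *_) (^-zeroˡ (∑ (suc m) δ)) ⟩
  suc k ^ suc m * 1                  ≡⟨ *-identityʳ _ ⟩
  suc k ^ suc m                      ∎)
  where
  open ≤-Reasoning
  W δ : Fin (suc m) → ℕ
  W i = ∑ (2 + k) (slot ⌊ i ≟ᶠ x ⌋ 1)
  δ i = ⟦ ⌊ i ≟ᶠ x ⌋ ⟧
  bound : ∀ i → W i * suc k ^ δ i ≤ suc k * 1 ^ δ i
  bound i rewrite ∑-slot k ⌊ i ≟ᶠ x ⌋ 1 with ⌊ i ≟ᶠ x ⌋
  ... | true  = ≤-reflexive (*-identityˡ _)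
  ... | false = ≤-refl

-- Dividing by k ^ (mult G x y) gives k ^ m * α ^ (mult G x y) on the right, with α = (k + 1) / k
-- and k = r - 2; there are m + 2 rows.
∑ᵛ-twoOnes : .{{NonZero k}} → (G : TCM (2 + m)) {x y : Fin (2 + m)} → x Fin.< y →
  ∑ᵛ (2 + m) (twoOnes {k = k} G x y) * k ^ mult G x y ≤ k ^ m * suc k ^ mult G x y
∑ᵛ-twoOnes {k} {m} G {x} {y} x<y = begin
  ∑ᵛ (2 + m) (twoOnes {k = k} G x y) * k ^ μ      ≡⟨ cong (_* k ^ μ) (∑ᵛ-∏ λ i → slot {k} (isEnd x y i) (t i)) ⟩
  ∏W * k ^ μ                                      ≡⟨ cong (λ e → ∏W * k ^ e) M+ ⟨
  ∏W * k ^ (M + (μ ∸ M))                          ≡⟨ cong (∏W *_) (^-distribˡ-+-* k M _) ⟩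
  ∏W * (k ^ M * k ^ (μ ∸ M))                      ≡⟨ *-assoc ∏W _ _ ⟨
  -- For the surplus μ - M, the factors k on the left are simply enlarged to k + 1.
  ∏W * k ^ M * k ^ (μ ∸ M)                        ≤⟨ *-mono-≤ main (^-monoˡ-≤ (μ ∸ M) (n≤1+n k)) ⟩
  k ^ m * suc k ^ M * suc k ^ (μ ∸ M)             ≡⟨ *-assoc (k ^ m) _ _ ⟩
  k ^ m * (suc k ^ M * suc k ^ (μ ∸ M))           ≡⟨ cong (k ^ m *_) (^-distribˡ-+-* (suc k) M _) ⟨
  k ^ m * suc k ^ (M + (μ ∸ M))                   ≡⟨ cong (λ e → k ^ m * suc k ^ e) M+ ⟩
  k ^ m * suc k ^ μ                               ∎
  where
  open ≤-Reasoning
  t W δx δy e : Fin (2 + m) → ℕ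
  t    = thirds G x y
  W i  = ∑ (2 + k) (slot (isEnd x y i) (t i))
  δx i = ⟦ ⌊ i ≟ᶠ x ⌋ ⟧
  δy i = ⟦ ⌊ i ≟ᶠ y ⌋ ⟧
  -- An end row has one option; an extra factor k brings it level with the k that `bound` has on the
  -- right for every row.
  e i  = (δx i + δy i) + t i
  μ M ∏W : ℕ
  μ = mult G x y
  M = ∑ (2 + m) t
  ∏W = ∏ (2 + m) W
  M+ : M + (μ ∸ M) ≡ μ
  M+ = m+[n∸m]≡n (∑-thirds≤mult G x y)
  ∑e : ∑ (2 + m) e ≡ 2 + M
  ∑e = trans (∑-distrib-+ (λ i → δx i + δy i) t)
    (cong (_+ M) (trans (∑-distrib-+ δx δy) (cong₂ _+_ (∑-indicator x) (∑-indicator y))))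
  bound : ∀ i → W i * k ^ e i ≤ k * suc k ^ t i
  bound i rewrite ∑-slot k (isEnd x y i) (t i) with i ≟ᶠ x | i ≟ᶠ y
  ... | yes refl | yes refl = contradiction x<y (<ᶠ-irrefl {x = x} refl)
  ... | no  _    | no  _    = bernoulli k (t i)
  ... | yes refl | no  _    rewrite thirds-endpointˡ G x<y = ≤-reflexive (+-identityʳ (k * 1))
  ... | no  _    | yes refl rewrite thirds-endpointʳ G x<y = ≤-reflexive (+-identityʳ (k * 1))
  main : ∏W * k ^ M ≤ k ^ m * suc k ^ M
  -- The extra factors k of the two end rows are cancelled, which lowers the exponent from m + 2 to
  -- m.
  main = *-cancelˡ-≤ (k ^ 2) {{m^n≢0 k 2}} (begin
    k ^ 2 * (∏W * k ^ M)            ≡⟨ x∙yz≈y∙xz (k ^ 2) ∏W _ ⟩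
    ∏W * (k ^ 2 * k ^ M)            ≡⟨ cong (∏W *_) (^-distribˡ-+-* k 2 M) ⟨
    ∏W * k ^ (2 + M)                ≡⟨ cong (λ s → ∏W * k ^ s) ∑e ⟨
    ∏W * k ^ ∑ (2 + m) e            ≤⟨ ∏-bound W e t {k} {k} {suc k} bound ⟩
    k ^ (2 + m) * suc k ^ M         ≡⟨ cong (_* suc k ^ M) (^-distribˡ-+-* k 2 m) ⟩
    k ^ 2 * k ^ m * suc k ^ M       ≡⟨ *-assoc (k ^ 2) _ _ ⟩
    k ^ 2 * (k ^ m * suc k ^ M)     ∎)

-- The members of the compressed family

data Ones (d : Vec (Fin (2 + k)) m) : Set where
  none : (∀ i → lookup d i ≢ 𝟙) → Ones d
  one  : ∀ x → lookup d x ≡ 𝟙 → (∀ i → lookup d i ≡ 𝟙 → i ≡ x) → Ones d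
  -- A third 1 is left open here; `no-third-𝟙` excludes it for members of the compressed family.
  two  : ∀ {x y} → x Fin.< y → lookup d x ≡ 𝟙 → lookup d y ≡ 𝟙 → Ones d

ones : (d : Vec (Fin (2 + k)) m) → Ones d
ones d with any? (λ x → lookup d x ≟ᶠ 𝟙)
... | no ¬any = none λ i di → ¬any (i , di)
... | yes (x , dx) with any? (λ y → ¬? (y ≟ᶠ x) ×-dec (lookup d y ≟ᶠ 𝟙))
...   | no ¬any = one x dx λ i di → decidable-stable (i ≟ᶠ x) λ i≢x → ¬any (i , i≢x , di)
...   | yes (y , y≢x , dy) with <ᶠ-cmp x y
...     | tri< x<y _ _ = two x<y dx dy
...     | tri≈ _ x≡y _ = contradiction (sym x≡y) y≢x
...     | tri> _ _ y<x = two y<x dy dx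

1≤cover : ∀ (G : TCM m) {d : Vec (Fin (2 + k)) m} → Ones d →
  (∀ {x y z} → x Fin.< y → lookup d x ≡ 𝟙 → lookup d y ≡ 𝟙 →
    z ≢ x → z ≢ y → lookup d z ≡ 𝟘 → 1 ≤ thirds G x y z) →
  (∀ {x y z} → x Fin.< y → lookup d x ≡ 𝟙 → lookup d y ≡ 𝟙 →
    z ≢ x → z ≢ y → lookup d z ≢ 𝟙) →
  1 ≤ cover G d
1≤cover {m} G {d} (none h) _ _ = ≤-trans (1≤∏ 1≤slot) (m≤m+n _ _)
  where
  1≤slot : ∀ i → 1 ≤ slot false 1 (lookup d i)
  1≤slot i with lookup d i in di
  ... | 𝟘    = ≤-refl
  ... | 𝟙    = contradiction di (h i)
  ... | 𝟚+ _ = ≤-refl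
1≤cover {m} G {d} (one x dx h) _ _ = ≤-trans (1≤∏ 1≤slot)
  (≤-trans (term≤∑ (λ x → oneOne x d) x) (≤-trans (m≤m+n _ _) (m≤n+m _ (noOnes d))))
  where
  1≤slot : ∀ i → 1 ≤ slot ⌊ i ≟ᶠ x ⌋ 1 (lookup d i)
  1≤slot i with i ≟ᶠ x
  ... | yes refl rewrite dx = ≤-refl
  ... | no i≢x with lookup d i in di
  ...   | 𝟘    = ≤-refl
  ...   | 𝟙    = contradiction (h i di) i≢x
  ...   | 𝟚+ _ = ≤-refl
1≤cover {m} G {d} (two {x} {y} x<y dx dy) third≥1 no-third =
  ≤-trans (1≤twoOnes G {d = d} dx dy (third≥1 x<y dx dy) (no-third x<y dx dy))
    (≤-trans (term≤∑<∑ (λ x y → twoOnes G x y d) x<y)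
      (≤-trans (m≤n+m _ (∑ m λ x → oneOne x d)) (m≤n+m _ (noOnes d))))

cong-vec₃ : {a b c a′ b′ c′ : Fin l} → a ≡ a′ → b ≡ b′ → c ≡ c′ →
  a ∷ b ∷ c ∷ [] ≡ a′ ∷ b′ ∷ c′ ∷ []
cong-vec₃ refl refl refl = refl

module _ (B : Choice m) (P : Family k m) (avoids : ∀ c → P c ≡ true → Avoids B (lookup c)) where

  private G = survivorTCM B

  module _ (d : Vec (Fin (2 + k)) m) (d∈ : compress P d ≡ true)
           {x y} (x<y : x Fin.< y) (dx : lookup d x ≡ 𝟙) (dy : lookup d y ≡ 𝟙) where

    -- On the triple xyz, `d` has 1s exactly at x and y, so the surviving pair there is xy.
    𝟘⇒third : ∀ {z} → z ≢ x → z ≢ y → lookup d z ≡ 𝟘 → 1 ≤ thirds G x y z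
    𝟘⇒third z≢x z≢y dz = 1≤thirds G x<y z≢x z≢y
      (λ p q → two-𝟙s B P avoids d d∈ p q (𝟚+ 𝟘) (cong-vec₃ dz dx dy))
      (λ p q → two-𝟙s B P avoids d d∈ p q 𝟙 (cong-vec₃ dx dz dy))
      (λ p q → two-𝟙s B P avoids d d∈ p q 𝟘 (cong-vec₃ dx dy dz))

    no-third-𝟙 : ∀ {z} → z ≢ x → z ≢ y → lookup d z ≢ 𝟙
    no-third-𝟙 {z} z≢x z≢y dz with <ᶠ-cmp z x | <ᶠ-cmp z y
    ... | tri≈ _ z≡x _ | _ = z≢x z≡x
    ... | _ | tri≈ _ z≡y _ = z≢y z≡y
    ... | tri< z<x _ _ | _ = no-three-𝟙s B P avoids d d∈ z<x x<y dz dx dy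
    ... | tri> _ _ x<z | tri< z<y _ _ = no-three-𝟙s B P avoids d d∈ x<z z<y dx dz dy
    ... | tri> _ _ x<z | tri> _ _ y<z = no-three-𝟙s B P avoids d d∈ x<y y<z dx dy dz

  compress≤cover : ∀ d → ⟦ compress P d ⟧ ≤ cover G d
  compress≤cover d = ⟦⟧≤ (compress P d) λ d∈ → 1≤cover G {d} (ones d)
    (λ x<y dx dy → 𝟘⇒third d d∈ x<y dx dy) (λ x<y dx dy → no-third-𝟙 d d∈ x<y dx dy)
    where
    ⟦⟧≤ : ∀ β {n} → (β ≡ true → 1 ≤ n) → ⟦ β ⟧ ≤ n
    ⟦⟧≤ false _ = z≤n
    ⟦⟧≤ true  h = h refl

∑ᵛ-if : ∀ β (f : Vec (Fin l) m → ℕ) → ∑ᵛ m (λ c → if β then f c else 0) ≡ (if β then ∑ᵛ m f else 0)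
∑ᵛ-if         true  f = refl
∑ᵛ-if {m = m} false f = ∑ᵛ-zero m

∑ᵛ-cover : (G : TCM (suc m)) → ∑ᵛ (suc m) (cover {k = k} G) ≤
  suc k ^ suc m + (suc m * suc k ^ m + ∑<∑ λ x y → ∑ᵛ (suc m) (twoOnes {k = k} G x y))
∑ᵛ-cover {m} {k} G = begin
  ∑ᵛ M (cover G)                                  ≡⟨ ∑ᵛ-distrib-+ {m = M} noOnes (λ d → ones₁ d + ones₂ d) ⟩
  ∑ᵛ M noOnes + ∑ᵛ M (λ d → ones₁ d + ones₂ d)    ≡⟨ cong₂ _+_ (∑ᵛ-noOnes {k} M) (∑ᵛ-distrib-+ {m = M} ones₁ ones₂) ⟩
  suc k ^ M + (∑ᵛ M ones₁ + ∑ᵛ M ones₂)           ≤⟨ +-monoʳ-≤ (suc k ^ M) (+-mono-≤ ones₁≤ (≤-reflexive ones₂≡)) ⟩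
  suc k ^ M + (M * suc k ^ m + ∑<∑ λ x y → ∑ᵛ M (twoOnes {k = k} G x y)) ∎
  where
  open ≤-Reasoning
  M = suc m
  ones₁ ones₂ : Vec (Fin (2 + k)) M → ℕ
  ones₁ d = ∑ M λ x → oneOne x d
  ones₂ d = ∑<∑ λ x y → twoOnes G x y d
  ones₁≤ : ∑ᵛ M ones₁ ≤ M * suc k ^ m
  ones₁≤ = begin
    ∑ᵛ M ones₁                              ≡⟨ ∑ᵛ-∑-comm {m = M} (λ d x → oneOne x d) ⟩
    ∑ M (λ x → ∑ᵛ M (oneOne {k = k} x))     ≤⟨ ∑-mono-≤ {M} ∑ᵛ-oneOne ⟩
    ∑ M (λ _ → suc k ^ m)                   ≡⟨ ∑-const M _ ⟩
    M * suc k ^ m                           ∎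
  pair : Vec (Fin (2 + k)) M → Fin M → Fin M → ℕ
  pair d x y = if ⌊ x Fin.<? y ⌋ then twoOnes G x y d else 0
  ones₂≡ : ∑ᵛ M ones₂ ≡ ∑<∑ λ x y → ∑ᵛ M (twoOnes {k = k} G x y)
  ones₂≡ = trans (∑ᵛ-∑-comm {m = M} (λ d x → ∑ M (pair d x))) (∑-cong {M} λ x →
           trans (∑ᵛ-∑-comm {m = M} (λ d → pair d x)) (∑-cong {M} λ y →
           ∑ᵛ-if {m = M} ⌊ x Fin.<? y ⌋ (twoOnes {k = k} G x y)))

-- The columns of a simple matrix

columns : Matrix m l n → Vec (Fin l) m → Bool
columns A c = ⌊ any? (λ i → ≡-dec _≟ᶠ_ (tabulate (A i)) c) ⌋

-- Double counting of pairs of an index and a vector: each index meets at least its own column, and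
-- by simplicity each vector meets at most one index.
simple⇒≤size : (A : Matrix m (2 + k) n) → Simple A → n ≤ size (columns A)
simple⇒≤size {m} {k} {n} A simple = begin
  n                                ≡⟨ trans (∑-const n 1) (*-identityʳ n) ⟨
  ∑ n (λ _ → 1)                    ≤⟨ ∑-mono-≤ {n} (λ i → ∑ᵛ-indicator (tabulate (A i))) ⟩
  ∑ n (λ i → ∑ᵛ m (λ c → eq c i))  ≡⟨ ∑ᵛ-∑-comm {m = m} eq ⟨
  ∑ᵛ m (λ c → ∑ n (eq c))          ≤⟨ ∑ᵛ-mono-≤ {m = m} at-most-one ⟩
  size (columns A)                 ∎
  where
  open ≤-Reasoning
  eq : Vec (Fin (2 + k)) m → Fin n → ℕ
  eq c i = ⟦ ⌊ ≡-dec _≟ᶠ_ (tabulate (A i)) c ⌋ ⟧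
  eq≤1 : ∀ c i → eq c i ≤ 1
  eq≤1 c i with ≡-dec _≟ᶠ_ (tabulate (A i)) c
  ... | yes _ = ≤-refl
  ... | no  _ = z≤n
  1≤eq : ∀ c i → 1 ≤ eq c i → tabulate (A i) ≡ c
  1≤eq c i 1≤ with ≡-dec _≟ᶠ_ (tabulate (A i)) c
  1≤eq c i 1≤ | yes p = p
  1≤eq c i () | no  _
  at-most-one : ∀ c → ∑ n (eq c) ≤ ⟦ columns A c ⟧
  at-most-one c with any? (λ i → ≡-dec _≟ᶠ_ (tabulate (A i)) c)
  ... | yes _ = ∑-at-most-one (eq c) (eq≤1 c) λ i j p q → simple i j λ z →
    trans (sym (lookup∘tabulate (A i) z))
      (trans (cong (λ v → lookup v z) (trans (1≤eq c i p) (sym (1≤eq c j q)))) (lookup∘tabulate (A j) z))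
  ... | no ¬any = ≤-trans (∑-mono-≤ {n} λ i → ≮⇒≥ λ p → ¬any (i , 1≤eq c i p)) (≤-reflexive (∑-zero n))

columns-avoid : (B : Choice m) (A : Matrix m l n) → (∀ i → Avoids B (A i)) →
  ∀ c → columns A c ≡ true → Avoids B (lookup c)
columns-avoid B A avoids c c∈ a b d p q (x , h) with any? (λ i → ≡-dec _≟ᶠ_ (tabulate (A i)) c)
... | yes (i , refl) = avoids i a b d p q
  (x , λ y → trans (cong toℕ (sym (lookup∘tabulate (A i) (pick a b d y)))) (h y))
columns-avoid B A avoids c () a b d p q (x , h) | no _

-- Passage to ℚ

-- `_/_` cancels common factors, so identities are verified on unnormalised fractions, where
-- equality is cross-multiplication.
fromℚᵘ-homo-+ : ∀ p q → fromℚᵘ (p ℚᵘ.+ q) ≡ fromℚᵘ p ℚ.+ fromℚᵘ q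
fromℚᵘ-homo-+ p q = ℚ.toℚᵘ-injective (begin
  toℚᵘ (fromℚᵘ (p ℚᵘ.+ q))              ≈⟨ ℚ.toℚᵘ-fromℚᵘ _ ⟩
  p ℚᵘ.+ q                              ≈⟨ ℚᵘ.+-cong (ℚ.toℚᵘ-fromℚᵘ p) (ℚ.toℚᵘ-fromℚᵘ q) ⟨
  toℚᵘ (fromℚᵘ p) ℚᵘ.+ toℚᵘ (fromℚᵘ q)  ≈⟨ ℚ.toℚᵘ-homo-+ (fromℚᵘ p) (fromℚᵘ q) ⟨
  toℚᵘ (fromℚᵘ p ℚ.+ fromℚᵘ q)          ∎)
  where open ℚᵘ.≃-Reasoning

fromℚᵘ-homo-* : ∀ p q → fromℚᵘ (p ℚᵘ.* q) ≡ fromℚᵘ p ℚ.* fromℚᵘ q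
fromℚᵘ-homo-* p q = ℚ.toℚᵘ-injective (begin
  toℚᵘ (fromℚᵘ (p ℚᵘ.* q))              ≈⟨ ℚ.toℚᵘ-fromℚᵘ _ ⟩
  p ℚᵘ.* q                              ≈⟨ ℚᵘ.*-cong (ℚ.toℚᵘ-fromℚᵘ p) (ℚ.toℚᵘ-fromℚᵘ q) ⟨
  toℚᵘ (fromℚᵘ p) ℚᵘ.* toℚᵘ (fromℚᵘ q)  ≈⟨ ℚ.toℚᵘ-homo-* (fromℚᵘ p) (fromℚᵘ q) ⟨
  toℚᵘ (fromℚᵘ p ℚ.* fromℚᵘ q)          ∎)
  where open ℚᵘ.≃-Reasoning

ℕtoℚ-homo-+ : ∀ a b → ℕtoℚ (a + b) ≡ ℕtoℚ a ℚ.+ ℕtoℚ b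
ℕtoℚ-homo-+ a b = trans
  (ℚ.fromℚᵘ-cong {mkℚᵘ (ℤ.+ (a + b)) 0} {mkℚᵘ (ℤ.+ a) 0 ℚᵘ.+ mkℚᵘ (ℤ.+ b) 0}
    (*≡* (cong (ℤ._* ℤ.+ 1) (sym (cong₂ ℤ._+_ (ℤ.*-identityʳ (ℤ.+ a)) (ℤ.*-identityʳ (ℤ.+ b)))))))
  (fromℚᵘ-homo-+ (mkℚᵘ (ℤ.+ a) 0) (mkℚᵘ (ℤ.+ b) 0))

ℕtoℚ-homo-* : ∀ a b → ℕtoℚ (a * b) ≡ ℕtoℚ a ℚ.* ℕtoℚ b
ℕtoℚ-homo-* a b = trans
  (ℚ.fromℚᵘ-cong {mkℚᵘ (ℤ.+ (a * b)) 0} {mkℚᵘ (ℤ.+ a) 0 ℚᵘ.* mkℚᵘ (ℤ.+ b) 0}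
    (*≡* (cong (ℤ._* ℤ.+ 1) (ℤ.pos-* a b))))
  (fromℚᵘ-homo-* (mkℚᵘ (ℤ.+ a) 0) (mkℚᵘ (ℤ.+ b) 0))

ℕtoℚ-mono-≤ : ∀ {a b} → a ≤ b → ℕtoℚ a ℚ.≤ ℕtoℚ b
ℕtoℚ-mono-≤ {a} {b} a≤b = ℚ.toℚᵘ-cancel-≤ (begin
  toℚᵘ (ℕtoℚ a)   ≃⟨ ℚ.toℚᵘ-fromℚᵘ (mkℚᵘ (ℤ.+ a) 0) ⟩
  mkℚᵘ (ℤ.+ a) 0  ≤⟨ *≤* (ℤ.*-monoʳ-≤-nonNeg (ℤ.+ 1) (ℤ.+≤+ a≤b)) ⟩
  mkℚᵘ (ℤ.+ b) 0  ≃⟨ ℚ.toℚᵘ-fromℚᵘ (mkℚᵘ (ℤ.+ b) 0) ⟨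
  toℚᵘ (ℕtoℚ b)   ∎)
  where open ℚᵘ.≤-Reasoning

ℕtoℚ-positive : ∀ a .{{_ : NonZero a}} → ℚ.Positive (ℕtoℚ a)
ℕtoℚ-positive (suc a) = ℚ.positive {ℕtoℚ (suc a)} (ℚ.<-≤-trans (ℚ.positive⁻¹ 1ℚ) (ℕtoℚ-mono-≤ {1} {suc a} (s≤s z≤n)))

-- From here on r is `3 + k`, so that `suc k` is r - 2 and `2 + k` is r - 1.
alpha-* : ∀ k → alpha (3 + k) ℚ.* ℕtoℚ (suc k) ≡ ℕtoℚ (2 + k)
alpha-* k = trans (sym (fromℚᵘ-homo-* (mkℚᵘ (ℤ.+ (2 + k)) k) (mkℚᵘ (ℤ.+ suc k) 0)))
  (ℚ.fromℚᵘ-cong {mkℚᵘ (ℤ.+ (2 + k)) k ℚᵘ.* mkℚᵘ (ℤ.+ suc k) 0} {mkℚᵘ (ℤ.+ (2 + k)) 0}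
    (*≡* (trans (ℤ.*-identityʳ _)
    (cong (λ d → ℤ.+ (2 + k) ℤ.* ℤ.+ d) (sym (*-identityʳ (suc k)))))))

alpha^-* : ∀ k t → (alpha (3 + k) ^ℚ t) ℚ.* ℕtoℚ (suc k ^ t) ≡ ℕtoℚ ((2 + k) ^ t)
alpha^-* k zero    = refl
alpha^-* k (suc t) = begin
  (α ℚ.* (α ^ℚ t)) ℚ.* ℕtoℚ (suc k * suc k ^ t)             ≡⟨ cong ((α ℚ.* (α ^ℚ t)) ℚ.*_) (ℕtoℚ-homo-* (suc k) (suc k ^ t)) ⟩
  (α ℚ.* (α ^ℚ t)) ℚ.* (ℕtoℚ (suc k) ℚ.* ℕtoℚ (suc k ^ t))  ≡⟨ *ℚ-interchange α (α ^ℚ t) (ℕtoℚ (suc k)) (ℕtoℚ (suc k ^ t)) ⟩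
  (α ℚ.* ℕtoℚ (suc k)) ℚ.* ((α ^ℚ t) ℚ.* ℕtoℚ (suc k ^ t))  ≡⟨ cong₂ ℚ._*_ (alpha-* k) (alpha^-* k t) ⟩
  ℕtoℚ (2 + k) ℚ.* ℕtoℚ ((2 + k) ^ t)                       ≡⟨ ℕtoℚ-homo-* (2 + k) ((2 + k) ^ t) ⟨
  ℕtoℚ ((2 + k) ^ suc t)                                    ∎
  where
  open ≡-Reasoning
  α = alpha (3 + k)

-- Multiplication by the positive number (r - 2)^t turns α^t into (r - 1)^t and leaves an inequality
-- of natural numbers.
≤-alpha^ : ∀ k t {e s} → e * suc k ^ t ≤ s * (2 + k) ^ t →
  ℕtoℚ e ℚ.≤ (alpha (3 + k) ^ℚ t) ℚ.* ℕtoℚ s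
≤-alpha^ k t {e} {s} le = ℚ.*-cancelʳ-≤-pos (ℕtoℚ kᵗ) {{ℕtoℚ-positive kᵗ {{m^n≢0 (suc k) t}}}} (begin
  ℕtoℚ e ℚ.* ℕtoℚ kᵗ             ≡⟨ ℕtoℚ-homo-* e kᵗ ⟨
  ℕtoℚ (e * kᵗ)                  ≤⟨ ℕtoℚ-mono-≤ {e * kᵗ} {s * (2 + k) ^ t} le ⟩
  ℕtoℚ (s * (2 + k) ^ t)         ≡⟨ ℕtoℚ-homo-* s ((2 + k) ^ t) ⟩
  ℕtoℚ s ℚ.* ℕtoℚ ((2 + k) ^ t)  ≡⟨ cong (ℕtoℚ s ℚ.*_) (alpha^-* k t) ⟨
  ℕtoℚ s ℚ.* (αᵗ ℚ.* ℕtoℚ kᵗ)    ≡⟨ ℚ.*-assoc (ℕtoℚ s) αᵗ (ℕtoℚ kᵗ) ⟨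
  ℕtoℚ s ℚ.* αᵗ ℚ.* ℕtoℚ kᵗ      ≡⟨ cong (ℚ._* ℕtoℚ kᵗ) (ℚ.*-comm (ℕtoℚ s) αᵗ) ⟩
  αᵗ ℚ.* ℕtoℚ s ℚ.* ℕtoℚ kᵗ      ∎)
  where
  open ℚ.≤-Reasoning
  kᵗ = suc k ^ t
  αᵗ = alpha (3 + k) ^ℚ t

∑ℚ-bound : ∀ (f : Fin n → ℕ) (g : Fin n → ℚ) s →
  (∀ i → ℕtoℚ (f i) ℚ.≤ g i ℚ.* s) → ℕtoℚ (∑ n f) ℚ.≤ ∑ℚ n g ℚ.* s
∑ℚ-bound {zero}  f g s le = ℚ.≤-reflexive (sym (ℚ.*-zeroˡ s))
∑ℚ-bound {suc n} f g s le = begin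
  ℕtoℚ (f Fin.zero + ∑ n (f ∘ Fin.suc))           ≡⟨ ℕtoℚ-homo-+ (f Fin.zero) (∑ n (f ∘ Fin.suc)) ⟩
  ℕtoℚ (f Fin.zero) ℚ.+ ℕtoℚ (∑ n (f ∘ Fin.suc))  ≤⟨ ℚ.+-mono-≤ (le Fin.zero) (∑ℚ-bound (f ∘ Fin.suc) (g ∘ Fin.suc) s (le ∘ Fin.suc)) ⟩
  g Fin.zero ℚ.* s ℚ.+ ∑ℚ n (g ∘ Fin.suc) ℚ.* s   ≡⟨ ℚ.*-distribʳ-+ s (g Fin.zero) (∑ℚ n (g ∘ Fin.suc)) ⟨
  ∑ℚ (suc n) g ℚ.* s                              ∎
  where open ℚ.≤-Reasoning

ℕ≤⇒difference≤ : ∀ {n a b e} {w : ℚ} → n ≤ a + (b + e) → ℕtoℚ e ℚ.≤ w →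
  (ℕtoℚ n ℚ.- ℕtoℚ a) ℚ.- ℕtoℚ b ℚ.≤ w
ℕ≤⇒difference≤ {n} {a} {b} {e} {w} n≤ e≤w = begin
  (ℕtoℚ n ℚ.- ℕtoℚ a) ℚ.- ℕtoℚ b
    ≤⟨ ℚ.+-monoˡ-≤ (ℚ.- ℕtoℚ b) (ℚ.+-monoˡ-≤ (ℚ.- ℕtoℚ a) (ℕtoℚ-mono-≤ {n} {a + (b + e)} n≤)) ⟩
  (ℕtoℚ (a + (b + e)) ℚ.- ℕtoℚ a) ℚ.- ℕtoℚ b
    ≡⟨ cong (λ t → (t ℚ.- ℕtoℚ a) ℚ.- ℕtoℚ b) (trans (ℕtoℚ-homo-+ a (b + e)) (cong (ℕtoℚ a ℚ.+_) (ℕtoℚ-homo-+ b e))) ⟩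
  ((ℕtoℚ a ℚ.+ (ℕtoℚ b ℚ.+ ℕtoℚ e)) ℚ.- ℕtoℚ a) ℚ.- ℕtoℚ b
    ≡⟨ cong (ℚ._- ℕtoℚ b) (xyx⁻¹≈y (ℕtoℚ a) (ℕtoℚ b ℚ.+ ℕtoℚ e)) ⟩
  (ℕtoℚ b ℚ.+ ℕtoℚ e) ℚ.- ℕtoℚ b  ≡⟨ xyx⁻¹≈y (ℕtoℚ b) (ℕtoℚ e) ⟩
  ℕtoℚ e                          ≤⟨ e≤w ⟩
  w                               ∎
  where
  open ℚ.≤-Reasoning

-- Both double sums are 0 off x < y and are compared termwise. The premise is what `∑ᵛ-twoOnes`
-- gives with `suc k` for its `k`.
∑<∑≤weight : ∀ k (G : TCM m) {s} (e : Fin m → Fin m → ℕ) →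
  (∀ {x y} → x Fin.< y → e x y * suc k ^ mult G x y ≤ s * (2 + k) ^ mult G x y) →
  ℕtoℚ (∑<∑ e) ≤ℚ weight G (alpha (3 + k)) *ℚ ℕtoℚ s
∑<∑≤weight {m} k G {s} e le =
  ∑ℚ-bound (λ x → ∑ m (f x)) (λ x → ∑ℚ m (g x)) (ℕtoℚ s) λ x →
  ∑ℚ-bound (f x) (g x) (ℕtoℚ s) λ y → pair (x Fin.<? y)
  where
  f : Fin m → Fin m → ℕ
  f x y = if ⌊ x Fin.<? y ⌋ then e x y else 0
  g : Fin m → Fin m → ℚ
  g x y = if ⌊ x Fin.<? y ⌋ then alpha (3 + k) ^ℚ mult G x y else 0ℚ
  pair : ∀ {x y} (x<?y : Dec (x Fin.< y)) → ℕtoℚ (if ⌊ x<?y ⌋ then e x y else 0) ≤ℚ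
    (if ⌊ x<?y ⌋ then alpha (3 + k) ^ℚ mult G x y else 0ℚ) *ℚ ℕtoℚ s
  pair {x} {y} (yes x<y) = ≤-alpha^ k (mult G x y) {e x y} {s} (le x<y)
  pair         (no  _)   = ℚ.≤-reflexive (sym (ℚ.*-zeroˡ (ℕtoℚ s)))

theorem3p4 : (m r : ℕ) → 3 ≤ r → (B : Choice m) → Bad B →
    (n : ℕ) (A : Matrix m r n) → Simple A → (∀ i → Avoids B (A i)) →
    Σ (TCM m) λ G → (((ℕtoℚ n -ℚ ℕtoℚ ((r ∸ 1) ^ m)) -ℚ ℕtoℚ (m * (r ∸ 1) ^ (m ∸ 1)))
    ≤ℚ (weight G (alpha r) *ℚ scale r m))
-- A bad choice provides a triple a < b < c, which is impossible on fewer than two rows.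
theorem3p4 zero       _ _ _ (() , _)
theorem3p4 (suc zero) _ _ _ (𝟘 , 𝟘 , _ , () , _)
-- `n` is bounded by the size of `columns A`, then of its compression, then by the sum of `cover`.
-- The first two parts of the latter are the subtracted terms; the third is bounded by the weight of
-- `G`, which is at most H, times (r - 2)^m.
theorem3p4 (suc (suc m)) _ (s≤s (s≤s (s≤s {n = k} z≤n))) B _ n A simple avoids = G , ℕ≤⇒difference≤
  {n} {(2 + k) ^ (2 + m)} {(2 + m) * (2 + k) ^ (1 + m)} {∑<∑ e}
  (≤-trans (simple⇒≤size A simple)
    (≤-trans (size≤compress (columns A))
      (≤-trans (∑ᵛ-mono-≤ {m = 2 + m} (compress≤cover B (columns A) (columns-avoid B A avoids)))
        (∑ᵛ-cover {k = suc k} G))))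
  (∑<∑≤weight k G {suc k ^ m} e (∑ᵛ-twoOnes {suc k} {m} G))
  where
  G = survivorTCM B
  e : Fin (2 + m) → Fin (2 + m) → ℕ
  e x y = ∑ᵛ (2 + m) (twoOnes {k = suc k} G x y)
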